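{- For every $k\ge1$, as formal power series, $$I_k(x)=I_{k-1}(x)+C_kx^kI_{k-1}(x)U_k(x)\qquad\text{and}\qquad U_k(x)=U_{k-1}(x)+C_kx^kU_{k-1}(x)U_k(x).$$
   Context: $C_k=\frac1{k+1}\binom{2k}{k}$ is the $k$-th Catalan number. Parking rules: $n$ spots $1,\dots,n$; cars $c_1,\dots,c_n$ arrive in order with preferences $a_j\in[n]$; $k$-Naples rule: $c_j$ parks at $a_j$ if empty, otherwise checks spots $a_j-1,\dots,a_j-k$ (those $\ge1$) in order and parks in the first empty one, otherwise drives forward from $a_j$ and parks in the first empty spot after $a_j$ (failing if none); a $k$-Naples parking function is a preference for which all cars park, and $0$-Naples parking functions are ordinary parking functions. $I_{n,k}$ is the number of ascending (weakly increasing) $k$-Naples parking functions of length $n$ and $U_{n,k}$ the number of those with first entry $1$; conventions: $I_{n,0}=C_n$ for $n\ge0$ (so $I_{0,k}=1$), $U_{n,0}=C_n$ for $n\ge1$, $U_{0,k}=0$ for all $k\ge0$. Set $I_k(x)=\sum_{n\ge0}I_{n,k}x^n$ and $U_k(x)=\sum_{n\ge0}U_{n,k}x^n$. -}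

module Defs where

open import Data.Bool using (Bool; true; false; not; _∧_; _∨_; if_then_else_)
open import Data.Nat using (ℕ; zero; suc; _+_; _*_; _∸_; _≡ᵇ_; _<ᵇ_)
open import Data.Nat.DivMod using (_/_)
open import Data.Nat.Combinatorics using (_C_)
open import Data.List using (List; []; _∷_; map; upTo; concatMap; filterᵇ; length; _++_)
open import Data.Bool.ListAction using (any)
open import Data.Maybe using (Maybe; just; nothing; is-just)

catalan : ℕ → ℕ
catalan k = ((2 * k) C k) / suc k

-- k-Naples parking procedure.  Spots are 1..n; the state is the list of
-- occupied spots.

free : List ℕ → ℕ → Bool
free occ s = not (any (λ t → t ≡ᵇ s) occ)

firstFree : List ℕ → List ℕ → Maybe ℕ
firstFree occ [] = nothing
firstFree occ (s ∷ ss) = if free occ s then just s else firstFree occ ss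

backCands : ℕ → ℕ → List ℕ
backCands k a = map (λ d → a ∸ d) (filterᵇ (λ d → d <ᵇ a) (map suc (upTo k)))

fwdCands : ℕ → ℕ → List ℕ
fwdCands n a = map (λ i → suc (a + i)) (upTo (n ∸ a))

chooseSpot : ℕ → ℕ → List ℕ → ℕ → Maybe ℕ
chooseSpot n k occ a =
  if free occ a then just a else firstFree occ (backCands k a ++ fwdCands n a)

runPark : ℕ → ℕ → List ℕ → List ℕ → Maybe (List ℕ)
runPark n k occ [] = just occ
runPark n k occ (a ∷ as) with chooseSpot n k occ a
... | nothing = nothing
... | just s  = runPark n k (s ∷ occ) as

isNaplesPF : ℕ → ℕ → List ℕ → Bool
isNaplesPF n k prefs = is-just (runPark n k [] prefs)

range : ℕ → ℕ → List ℕ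
range lo hi = map (lo +_) (upTo (suc hi ∸ lo))

ascSeqs : ℕ → ℕ → ℕ → List (List ℕ)
ascSeqs zero lo hi = [] ∷ []
ascSeqs (suc l) lo hi = concatMap (λ a → map (a ∷_) (ascSeqs l a hi)) (range lo hi)

startsWith1 : List ℕ → Bool
startsWith1 [] = false
startsWith1 (a ∷ _) = a ≡ᵇ 1

I : ℕ → ℕ → ℕ
I n k = length (filterᵇ (isNaplesPF n k) (ascSeqs n 1 n))

U : ℕ → ℕ → ℕ
U n k = length (filterᵇ (λ p → isNaplesPF n k p ∧ startsWith1 p) (ascSeqs n 1 n))

FPS : Set
FPS = ℕ → ℕ

Iser : ℕ → FPS
Iser k n = I n k

User : ℕ → FPS
User k n = U n k

_⊕_ : FPS → FPS → FPS
(f ⊕ g) n = f n + g n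

sumTo : ℕ → (ℕ → ℕ) → ℕ
sumTo zero h = h 0
sumTo (suc m) h = sumTo m h + h (suc m)

_⊛_ : FPS → FPS → FPS
(f ⊛ g) n = sumTo n (λ i → f i * g (n ∸ i))

monomial : ℕ → ℕ → FPS
monomial c k n = if n ≡ᵇ k then c else 0

-- Read an ascending preference list as a lattice path: an up step for each car
-- preferring the current spot a, a down step for passing from a to a + 1.  While
-- the path is above level 0, spots are filled from the left without gaps.  When
-- it dips below, gaps accumulate and later cars back up to the nearest one; the
-- leftmost gap of a dip can be filled exactly when the dip has at most k down
-- steps.  A dip, which may touch level 0 before rising above it, can be shaped in
-- C_j ways when it has j down steps, so splitting a path
-- at its first dip gives I_k = 1 + (Σ_{j≤k} C_j x^j) U_k, while the path counts
-- from height h satisfy A_{h+1} = x A_{h+2} + A_h with A_0 = I_k and x A_1 = U_k.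
-- This system has a unique solution, and A_h + C_{k+1} x^{k+1} A_h U_{k+1}
-- solves the system of k + 1.
module Submission where

open import Defs
open import Data.Bool using (Bool; true; false; _∧_; if_then_else_; T?)
open import Data.Bool.Properties using (∧-zeroʳ; ∧-identityʳ)
open import Data.Empty using (⊥; ⊥-elim)
open import Data.List using (List; []; _∷_; _++_; map; applyUpTo; concatMap; filterᵇ; length)
open import Data.List.Properties using (filter-++; length-++; map-upTo)
open import Data.List.Relation.Unary.All as All using (All; []; _∷_)
open import Data.List.Relation.Unary.All.Properties using (++⁺)
open import Data.Maybe using (just; nothing; is-just)
open import Data.Nat using (ℕ; zero; suc; _+_; _*_; _∸_; _≤_; _<_; z≤n; s≤s; s≤s⁻¹; _<ᵇ_; _≡ᵇ_)
open import Data.Nat.Combinatorics using (_C_; nCk≡nC[n∸k]; nCk+nC[k+1]≡[n+1]C[k+1]; nC1≡n; k>n⇒nCk≡0)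
open import Data.Nat.DivMod using (_/_; m*n/n≡m; /-congˡ)
open import Data.Nat.Properties
open import Data.Nat.Tactic.RingSolver using (solve-∀)
open import Data.Product using (∃; _×_; _,_; proj₁; proj₂)
open import Function using (_∘_)
open import Relation.Binary using (tri<; tri≈; tri>)
open import Relation.Binary.PropositionalEquality using (_≡_; _≢_; _≗_; refl; sym; ≢-sym; trans; cong; cong₂; subst; module ≡-Reasoning)
open import Relation.Nullary using (yes; no; contradiction)
open import Relation.Nullary.Decidable using (dec-true; dec-false)

open ≡-Reasoning

-- Ballot numbers and Catalan numbers.

-- ballot j g: nonpositive paths from depth g to level 0 with j down and j + g up steps.
ballot : ℕ → ℕ → ℕ
ballot zero    g       = 1
ballot (suc j) zero    = ballot j 1
ballot (suc j) (suc g) = ballot (suc j) g + ballot j (suc (suc g))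

pascal : ∀ n k → suc n C suc k ≡ n C k + n C suc k
pascal n k = sym (nCk+nC[k+1]≡[n+1]C[k+1] n k)

-- Induction with Pascal's rule on both sides. Writing the row as `k + m` turns the usual factor n -
-- k into `m`, so no truncated subtraction occurs.
C-absorb : ∀ k m → suc k * ((k + m) C suc k) ≡ m * ((k + m) C k)
C-absorb zero m = trans (*-identityˡ _) (trans (nC1≡n m) (sym (*-identityʳ m)))
C-absorb (suc k) zero
  rewrite +-identityʳ k | k>n⇒nCk≡0 (n<1+n (suc k)) = *-zeroʳ k
C-absorb (suc k) (suc m) = begin
  suc (suc k) * (suc (k + suc m) C suc (suc k))
    ≡⟨ cong (suc (suc k) *_) (pascal (k + suc m) (suc k)) ⟩
  suc (suc k) * (y + z)
    ≡⟨ regroup k y z ⟩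
  suc k * y + y + suc (suc k) * z
    ≡⟨ cong₂ (λ u v → u + y + v) (C-absorb k (suc m)) ih ⟩
  suc m * x + y + m * y
    ≡⟨ regroup′ m x y ⟩
  suc m * (x + y)
    ≡⟨ cong (suc m *_) (pascal (k + suc m) k) ⟨
  suc m * (suc (k + suc m) C suc k) ∎
  where
  x = (k + suc m) C k
  y = (k + suc m) C suc k
  z = (k + suc m) C suc (suc k)
  ih : suc (suc k) * z ≡ m * y
  ih rewrite +-suc k m = C-absorb (suc k) m
  regroup : ∀ k y z → suc (suc k) * (y + z) ≡ suc k * y + y + suc (suc k) * z
  regroup = solve-∀
  regroup′ : ∀ m x y → suc m * x + y + m * y ≡ suc m * (x + y)
  regroup′ = solve-∀

C-middle : ∀ j → suc (j + j) C suc j ≡ suc (j + j) C j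
C-middle j = trans (nCk≡nC[n∸k] (s≤s (m≤m+n j j))) (cong (suc (j + j) C_) (m+n∸m≡n j j))

-- The reflection principle: `suc n C j` counts the paths that rise above level 0. The proof checks
-- that both sides satisfy the recursion of `ballot`, by Pascal's rule; at depth 0 it uses that an
-- odd row is symmetric about its middle. The equation is additive to avoid subtraction.
ballot-reflection : ∀ j g n → n ≡ suc (g + (j + j)) →
  ballot (suc j) g + suc n C j ≡ suc n C suc j
ballot-reflection zero    zero    .1 refl = refl
ballot-reflection (suc i) zero    n  n≡   = begin
  ballot (suc i) 1 + suc n C suc i           ≡⟨ cong (ballot (suc i) 1 +_) (pascal n i) ⟩
  ballot (suc i) 1 + (n C i + n C suc i)     ≡⟨ +-assoc (ballot (suc i) 1) _ _ ⟨
  ballot (suc i) 1 + n C i + n C suc i       ≡⟨ cong₂ _+_ ih middle ⟩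
  n C suc i + n C suc (suc i)                ≡⟨ pascal n (suc i) ⟨
  suc n C suc (suc i)                        ∎
  where
  middle : n C suc i ≡ n C suc (suc i)
  middle rewrite n≡ = sym (C-middle (suc i))
  n≡′ : n ≡ suc (suc (suc (i + i)))
  n≡′ = trans n≡ (cong (suc ∘ suc) (+-suc i i))
  ih : ballot (suc i) 1 + n C i ≡ n C suc i
  ih rewrite n≡′ = ballot-reflection i 1 (suc (suc (i + i))) refl
ballot-reflection zero (suc g) .(suc (suc g + 0)) refl = begin
  ballot 1 g + 1 + 1          ≡⟨ +-comm (ballot 1 g + 1) 1 ⟩
  1 + (ballot 1 g + 1)        ≡⟨ cong suc (ballot-reflection zero g (suc (g + 0)) refl) ⟩
  1 + (suc (suc (g + 0)) C 1) ≡⟨ pascal (suc (suc (g + 0))) 0 ⟨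
  suc (suc (suc (g + 0))) C 1 ∎
ballot-reflection (suc i) (suc g) .(suc (suc g + (suc i + suc i))) refl = begin
  b + b′ + suc n C suc i               ≡⟨ cong (b + b′ +_) (pascal n i) ⟩
  b + b′ + (n C i + n C suc i)         ≡⟨ regroup b b′ (n C i) (n C suc i) ⟩
  b′ + n C i + (b + n C suc i)         ≡⟨ cong₂ _+_ (ballot-reflection i (suc (suc g)) (suc (g + (suc i + suc i))) n≡)
                                                       (ballot-reflection (suc i) g (suc (g + (suc i + suc i))) refl) ⟩
  n C suc i + n C suc (suc i)          ≡⟨ pascal n (suc i) ⟨
  suc n C suc (suc i)                  ∎
  where
  n  = suc (suc g + (suc i + suc i))
  b  = ballot (suc (suc i)) g
  b′ = ballot (suc i) (suc (suc g))
  regroup : ∀ b b′ x y → b + b′ + (x + y) ≡ b′ + x + (b + y)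
  regroup = solve-∀
  n≡ : suc (g + (suc i + suc i)) ≡ suc (suc (suc g) + (i + i))
  n≡ = cong suc (trans (cong (λ m → g + suc m) (+-suc i i))
         (trans (+-suc g _) (cong suc (+-suc g (i + i)))))

catalan≡ballot : ∀ k → catalan k ≡ ballot k 0
catalan≡ballot zero    = refl
catalan≡ballot (suc j) = begin
  (n C suc j) / suc (suc j)     ≡⟨ /-congˡ {o = suc (suc j)} (sym key) ⟩
  (b * suc (suc j)) / suc (suc j) ≡⟨ m*n/n≡m b (suc (suc j)) ⟩
  b                             ∎
  where
  n = 2 * suc j
  b = ballot (suc j) 0
  reflection : b + n C j ≡ n C suc j
  reflection = ballot-reflection j 0 (j + suc (j + 0)) (trans (+-suc j _) (cong (λ m → suc (j + m)) (+-identityʳ j)))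
  absorb : suc j * (n C suc j) ≡ suc (suc j) * (n C j)
  absorb = subst (λ m → suc j * (m C suc j) ≡ suc (suc j) * (m C j)) (e j) (C-absorb j (suc (suc j)))
    where
    e : ∀ j → j + suc (suc j) ≡ 2 * suc j
    e = solve-∀
  -- The division is exact: after adding `suc j * (n C suc j)`, absorption and reflection turn the
  -- left side into `suc (suc j) * (n C suc j)`, which unfolds to the right side.
  key : b * suc (suc j) ≡ n C suc j
  key = +-cancelʳ-≡ (suc j * (n C suc j)) _ _ (begin
    b * suc (suc j) + suc j * (n C suc j)       ≡⟨ cong₂ _+_ (*-comm b (suc (suc j))) absorb ⟩
    suc (suc j) * b + suc (suc j) * (n C j)     ≡⟨ *-distribˡ-+ (suc (suc j)) b (n C j) ⟨
    suc (suc j) * (b + n C j)                   ≡⟨ cong (suc (suc j) *_) reflection ⟩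
    suc (suc j) * (n C suc j)                   ∎)

-- Convolution algebra of power series.

tail : FPS → FPS
tail f n = f (suc n)

shift : FPS → FPS
shift f zero    = 0
shift f (suc n) = f n

one : FPS
one zero    = 1
one (suc n) = 0

sumTo-suc : ∀ m h → sumTo (suc m) h ≡ h 0 + sumTo m (h ∘ suc)
sumTo-suc zero    h = refl
sumTo-suc (suc m) h = trans (cong (_+ h (suc (suc m))) (sumTo-suc m h)) (+-assoc (h 0) _ _)

-- This recursion drives the convolution laws: they go by induction on the coefficient with `f`
-- replaced by `tail f`, so no double sum is ever reindexed.
⊛-suc : ∀ f g n → (f ⊛ g) (suc n) ≡ f 0 * g (suc n) + (tail f ⊛ g) n
⊛-suc f g n = sumTo-suc n (λ i → f i * g (suc n ∸ i))

⊛-sucʳ : ∀ f g n → (f ⊛ g) (suc n) ≡ (f ⊛ tail g) n + f (suc n) * g 0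
⊛-sucʳ f g zero    = refl
⊛-sucʳ f g (suc n) = begin
  (f ⊛ g) (suc (suc n))
    ≡⟨ ⊛-suc f g (suc n) ⟩
  f 0 * g (suc (suc n)) + (tail f ⊛ g) (suc n)
    ≡⟨ cong (f 0 * g (suc (suc n)) +_) (⊛-sucʳ (tail f) g n) ⟩
  f 0 * g (suc (suc n)) + ((tail f ⊛ tail g) n + f (suc (suc n)) * g 0)
    ≡⟨ +-assoc (f 0 * g (suc (suc n))) _ _ ⟨
  f 0 * g (suc (suc n)) + (tail f ⊛ tail g) n + f (suc (suc n)) * g 0
    ≡⟨ cong (_+ f (suc (suc n)) * g 0) (⊛-suc f (tail g) n) ⟨
  (f ⊛ tail g) (suc n) + f (suc (suc n)) * g 0 ∎

-- Coefficient `n` of a product sees only coefficients up to `n` of the factors. The uniqueness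
-- argument needs this form, since its induction hypothesis covers only small indices.
⊛-cong-≤ : ∀ n {f f′ g g′} → (∀ m → m ≤ n → f m ≡ f′ m) → (∀ m → m ≤ n → g m ≡ g′ m) →
  (f ⊛ g) n ≡ (f′ ⊛ g′) n
⊛-cong-≤ zero    f≡ g≡ = cong₂ _*_ (f≡ 0 z≤n) (g≡ 0 z≤n)
⊛-cong-≤ (suc n) {f} {f′} {g} {g′} f≡ g≡ = begin
  (f ⊛ g) (suc n)                        ≡⟨ ⊛-suc f g n ⟩
  f 0 * g (suc n) + (tail f ⊛ g) n       ≡⟨ cong₂ _+_ (cong₂ _*_ (f≡ 0 z≤n) (g≡ (suc n) ≤-refl))
                                              (⊛-cong-≤ n (λ m m≤n → f≡ (suc m) (s≤s m≤n)) (λ m m≤n → g≡ m (m≤n⇒m≤1+n m≤n))) ⟩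
  f′ 0 * g′ (suc n) + (tail f′ ⊛ g′) n   ≡⟨ ⊛-suc f′ g′ n ⟨
  (f′ ⊛ g′) (suc n)                      ∎

⊛-cong : ∀ {f f′ g g′} → f ≗ f′ → g ≗ g′ → f ⊛ g ≗ f′ ⊛ g′
⊛-cong {f} {f′} {g} {g′} f≗ g≗ n = ⊛-cong-≤ n {f} {f′} {g} {g′} (λ m _ → f≗ m) (λ m _ → g≗ m)

⊛-congˡ : ∀ {f f′} g → f ≗ f′ → f ⊛ g ≗ f′ ⊛ g
⊛-congˡ {f} {f′} g f≗ = ⊛-cong {f} {f′} {g} {g} f≗ (λ _ → refl)

⊛-congʳ : ∀ f {g g′} → g ≗ g′ → f ⊛ g ≗ f ⊛ g′
⊛-congʳ f {g} {g′} = ⊛-cong {f} {f} {g} {g′} (λ _ → refl)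

⊛-comm : ∀ f g → f ⊛ g ≗ g ⊛ f
⊛-comm f g zero    = *-comm (f 0) (g 0)
⊛-comm f g (suc n) = begin
  (f ⊛ g) (suc n)                    ≡⟨ ⊛-suc f g n ⟩
  f 0 * g (suc n) + (tail f ⊛ g) n   ≡⟨ cong₂ _+_ (*-comm (f 0) _) (⊛-comm (tail f) g n) ⟩
  g (suc n) * f 0 + (g ⊛ tail f) n   ≡⟨ +-comm (g (suc n) * f 0) _ ⟩
  (g ⊛ tail f) n + g (suc n) * f 0   ≡⟨ ⊛-sucʳ g f n ⟨
  (g ⊛ f) (suc n)                    ∎

⊛-distribʳ : ∀ h f g → (f ⊕ g) ⊛ h ≗ (f ⊛ h) ⊕ (g ⊛ h)
⊛-distribʳ h f g zero    = *-distribʳ-+ (h 0) (f 0) (g 0)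
⊛-distribʳ h f g (suc n) = begin
  ((f ⊕ g) ⊛ h) (suc n)
    ≡⟨ ⊛-suc (f ⊕ g) h n ⟩
  (f 0 + g 0) * h (suc n) + ((tail f ⊕ tail g) ⊛ h) n
    ≡⟨ cong ((f 0 + g 0) * h (suc n) +_) (⊛-distribʳ h (tail f) (tail g) n) ⟩
  (f 0 + g 0) * h (suc n) + ((tail f ⊛ h) n + (tail g ⊛ h) n)
    ≡⟨ regroup (f 0) (g 0) (h (suc n)) _ _ ⟩
  f 0 * h (suc n) + (tail f ⊛ h) n + (g 0 * h (suc n) + (tail g ⊛ h) n)
    ≡⟨ cong₂ _+_ (⊛-suc f h n) (⊛-suc g h n) ⟨
  (f ⊛ h) (suc n) + (g ⊛ h) (suc n) ∎
  where
  regroup : ∀ a b c x y → (a + b) * c + (x + y) ≡ a * c + x + (b * c + y)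
  regroup = solve-∀

⊛-distribˡ : ∀ h f g → h ⊛ (f ⊕ g) ≗ (h ⊛ f) ⊕ (h ⊛ g)
⊛-distribˡ h f g n = begin
  (h ⊛ (f ⊕ g)) n         ≡⟨ ⊛-comm h (f ⊕ g) n ⟩
  ((f ⊕ g) ⊛ h) n         ≡⟨ ⊛-distribʳ h f g n ⟩
  (f ⊛ h) n + (g ⊛ h) n   ≡⟨ cong₂ _+_ (⊛-comm f h n) (⊛-comm g h n) ⟩
  (h ⊛ f) n + (h ⊛ g) n   ∎

scale-⊛ : ∀ c f g → (λ n → c * f n) ⊛ g ≗ (λ n → c * (f ⊛ g) n)
scale-⊛ c f g zero    = *-assoc c (f 0) (g 0)
scale-⊛ c f g (suc n) = begin
  ((λ m → c * f m) ⊛ g) (suc n)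
    ≡⟨ ⊛-suc (λ m → c * f m) g n ⟩
  c * f 0 * g (suc n) + ((λ m → c * f (suc m)) ⊛ g) n
    ≡⟨ cong₂ _+_ (*-assoc c (f 0) (g (suc n))) (scale-⊛ c (tail f) g n) ⟩
  c * (f 0 * g (suc n)) + c * (tail f ⊛ g) n
    ≡⟨ *-distribˡ-+ c (f 0 * g (suc n)) _ ⟨
  c * (f 0 * g (suc n) + (tail f ⊛ g) n)
    ≡⟨ cong (c *_) (⊛-suc f g n) ⟨
  c * (f ⊛ g) (suc n) ∎

⊛-assoc : ∀ f g h → (f ⊛ g) ⊛ h ≗ f ⊛ (g ⊛ h)
⊛-assoc f g h zero    = *-assoc (f 0) (g 0) (h 0)
⊛-assoc f g h (suc n) = begin
  ((f ⊛ g) ⊛ h) (suc n)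
    ≡⟨ ⊛-suc (f ⊛ g) h n ⟩
  f 0 * g 0 * h (suc n) + (tail (f ⊛ g) ⊛ h) n
    ≡⟨ cong (f 0 * g 0 * h (suc n) +_) (⊛-congˡ h (⊛-suc f g) n) ⟩
  f 0 * g 0 * h (suc n) + (((λ m → f 0 * g (suc m)) ⊕ (tail f ⊛ g)) ⊛ h) n
    ≡⟨ cong (f 0 * g 0 * h (suc n) +_) (⊛-distribʳ h (λ m → f 0 * g (suc m)) (tail f ⊛ g) n) ⟩
  f 0 * g 0 * h (suc n) + (((λ m → f 0 * g (suc m)) ⊛ h) n + ((tail f ⊛ g) ⊛ h) n)
    ≡⟨ cong₂ (λ u v → f 0 * g 0 * h (suc n) + (u + v)) (scale-⊛ (f 0) (tail g) h n) (⊛-assoc (tail f) g h n) ⟩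
  f 0 * g 0 * h (suc n) + (f 0 * (tail g ⊛ h) n + (tail f ⊛ (g ⊛ h)) n)
    ≡⟨ regroup (f 0) (g 0) (h (suc n)) _ _ ⟩
  f 0 * (g 0 * h (suc n) + (tail g ⊛ h) n) + (tail f ⊛ (g ⊛ h)) n
    ≡⟨ cong (λ u → f 0 * u + (tail f ⊛ (g ⊛ h)) n) (⊛-suc g h n) ⟨
  f 0 * (g ⊛ h) (suc n) + (tail f ⊛ (g ⊛ h)) n
    ≡⟨ ⊛-suc f (g ⊛ h) n ⟨
  (f ⊛ (g ⊛ h)) (suc n) ∎
  where
  regroup : ∀ a b c x y → a * b * c + (a * x + y) ≡ a * (b * c + x) + y
  regroup = solve-∀

⊛-zeroˡ : ∀ g → (λ _ → 0) ⊛ g ≗ (λ _ → 0)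
⊛-zeroˡ g zero    = refl
⊛-zeroˡ g (suc n) = trans (⊛-suc (λ _ → 0) g n) (⊛-zeroˡ g n)

⊛-identityˡ : ∀ g → one ⊛ g ≗ g
⊛-identityˡ g zero    = *-identityˡ (g 0)
⊛-identityˡ g (suc n) = begin
  (one ⊛ g) (suc n)                      ≡⟨ ⊛-suc one g n ⟩
  1 * g (suc n) + ((λ _ → 0) ⊛ g) n      ≡⟨ cong₂ _+_ (*-identityˡ (g (suc n))) (⊛-zeroˡ g n) ⟩
  g (suc n) + 0                          ≡⟨ +-identityʳ _ ⟩
  g (suc n)                              ∎

shift-⊛ : ∀ f g → shift f ⊛ g ≗ shift (f ⊛ g)
shift-⊛ f g zero    = refl
shift-⊛ f g (suc n) = ⊛-suc (shift f) g n

-- Path counts above and below level 0, and the split at the first dip.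

-- l is the number of cars still to come.  In above, h is the current level; in
-- below, g + 1 is the number of free spots up to the current one, and t is the
-- number of further down steps that put the leftmost gap out of reach.
above : (k l h : ℕ) → ℕ
below : (k l g t : ℕ) → ℕ

above k zero    zero    = 1
above k (suc l) zero    = below k (suc l) zero (suc k)
above k zero    (suc h) = above k zero h
above k (suc l) (suc h) = above k l (suc (suc h)) + above k (suc l) h

below k zero    g       t       = 0
below k (suc l) g       zero    = 0
below k (suc l) zero    (suc t) = above k l 1 + below k (suc l) 1 t
below k (suc l) (suc g) (suc t) = below k l g (suc t) + below k (suc l) (suc (suc g)) t

-- The series A_h; the exponent is the number of cars still to come.
aboveSer : ℕ → ℕ → FPS
aboveSer k h l = above k l h

above-zero : ∀ k h → above k 0 h ≡ 1
above-zero k zero    = refl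
above-zero k (suc h) = above-zero k h

aboveSer-suc : ∀ k h → aboveSer k (suc h) ≗ shift (aboveSer k (suc (suc h))) ⊕ aboveSer k h
aboveSer-suc k h zero    = refl
aboveSer-suc k h (suc l) = refl

-- At most `g` cars cannot fill `g + 1` gaps. Paths that run past the last spot are counted as 0 in
-- this way, so `above` and `below` need no parameter for the number of spots.
below-vanishes : ∀ k l g t → l ≤ g → below k l g t ≡ 0
below-vanishes k zero    g       t       l≤g = refl
below-vanishes k (suc l) g       zero    l≤g = refl
below-vanishes k (suc l) (suc g) (suc t) l≤g =
  cong₂ _+_ (below-vanishes k l g (suc t) (s≤s⁻¹ l≤g))
            (below-vanishes k (suc l) (suc (suc g)) t (m≤n⇒m≤1+n l≤g))

-- A series in the number `j` of further down steps. The bound is strict because the down step that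
-- uses up `t` already puts the leftmost gap out of reach.
truncatedBallot : ℕ → ℕ → FPS
truncatedBallot g t j = if j <ᵇ t then ballot j g else 0

truncatedBallot-suc : ∀ g t →
  tail (truncatedBallot (suc g) (suc t)) ≗ tail (truncatedBallot g (suc t)) ⊕ truncatedBallot (suc (suc g)) t
truncatedBallot-suc g t j with j <ᵇ t
... | true  = refl
... | false = refl

-- Split at the first rise to level 1. With `j` further down steps, the return to level 0 takes
-- `g + j` up steps and has `ballot j g` shapes; `shift` pays for the up step that leaves level 0,
-- and the rest is counted from level 1.
below-ballot : ∀ k l g t → below k (g + l) g t ≡ (truncatedBallot g t ⊛ shift (aboveSer k 1)) l
below-ballot k l g zero = trans (fuelless (g + l)) (sym (⊛-zeroˡ (shift (aboveSer k 1)) l))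
  where
  fuelless : ∀ l → below k l g 0 ≡ 0
  fuelless zero    = refl
  fuelless (suc l) = refl
below-ballot k zero    g (suc t) =
  trans (below-vanishes k (g + 0) g (suc t) (≤-reflexive (+-identityʳ g))) (sym (*-zeroʳ (truncatedBallot g (suc t) 0)))
below-ballot k (suc l) zero (suc t) = begin
  above k l 1 + below k (suc l) 1 t
    ≡⟨ cong₂ _+_ (sym (*-identityˡ (above k l 1))) (below-ballot k l 1 t) ⟩
  1 * above k l 1 + (truncatedBallot 1 t ⊛ u) l
    ≡⟨ ⊛-suc (truncatedBallot 0 (suc t)) u l ⟨
  (truncatedBallot 0 (suc t) ⊛ u) (suc l) ∎
  where u = shift (aboveSer k 1)
below-ballot k (suc l) (suc g) (suc t) = begin
  below k (g + suc l) g (suc t) + below k (suc (g + suc l)) (suc (suc g)) t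
    ≡⟨ cong₂ _+_ (below-ballot k (suc l) g (suc t)) deeper ⟩
  (truncatedBallot g (suc t) ⊛ u) (suc l) + (truncatedBallot (suc (suc g)) t ⊛ u) l
    ≡⟨ cong (_+ (truncatedBallot (suc (suc g)) t ⊛ u) l) (⊛-suc (truncatedBallot g (suc t)) u l) ⟩
  1 * u (suc l) + (tail (truncatedBallot g (suc t)) ⊛ u) l + (truncatedBallot (suc (suc g)) t ⊛ u) l
    ≡⟨ +-assoc (1 * u (suc l)) _ _ ⟩
  1 * u (suc l) + ((tail (truncatedBallot g (suc t)) ⊛ u) l + (truncatedBallot (suc (suc g)) t ⊛ u) l)
    ≡⟨ cong (1 * u (suc l) +_) (⊛-distribʳ u (tail (truncatedBallot g (suc t))) _ l) ⟨
  1 * u (suc l) + ((tail (truncatedBallot g (suc t)) ⊕ truncatedBallot (suc (suc g)) t) ⊛ u) l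
    ≡⟨ cong (1 * u (suc l) +_) (⊛-congˡ u (truncatedBallot-suc g t) l) ⟨
  1 * u (suc l) + (tail (truncatedBallot (suc g) (suc t)) ⊛ u) l
    ≡⟨ ⊛-suc (truncatedBallot (suc g) (suc t)) u l ⟨
  (truncatedBallot (suc g) (suc t) ⊛ u) (suc l) ∎
  where
  u = shift (aboveSer k 1)
  deeper : below k (suc (g + suc l)) (suc (suc g)) t ≡ (truncatedBallot (suc (suc g)) t ⊛ u) l
  deeper rewrite +-suc g l = below-ballot k l (suc (suc g)) t

aboveSer-zero : ∀ k → aboveSer k 0 ≗ one ⊕ (truncatedBallot 0 (suc k) ⊛ shift (aboveSer k 1))
aboveSer-zero k zero    = refl
aboveSer-zero k (suc l) = below-ballot k (suc l) zero (suc k)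

-- The source of the Catalan coefficient: raising the bound by one admits exactly the dips with `k`
-- down steps.
truncatedBallot-extend : ∀ k →
  truncatedBallot 0 (suc k) ≗ monomial (catalan k) k ⊕ truncatedBallot 0 k
truncatedBallot-extend k j with <-cmp j k
... | tri< j<k j≢k _
  rewrite dec-true (j <? suc k) (m<n⇒m<1+n j<k) | dec-false (j ≟ k) j≢k | dec-true (j <? k) j<k = refl
... | tri≈ _ refl _
  rewrite dec-true (j <? suc j) ≤-refl | dec-true (j ≟ j) refl | dec-false (j <? j) (n≮n j) =
    trans (sym (catalan≡ballot j)) (sym (+-identityʳ (catalan j)))
... | tri> j≮k j≢k k<j
  rewrite dec-false (j <? suc k) (<⇒≱ (s≤s k<j)) | dec-false (j ≟ k) j≢k | dec-false (j <? k) j≮k = refl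

-- The linear system for the path series and its unique solution.

-- An arbitrary constant term `p` may absorb a series that is itself built from one of the
-- solutions.
record Solves (p s : FPS) (r : ℕ → FPS) : Set where
  field
    initial : r 0 ≗ p ⊕ (s ⊛ shift (r 1))
    step    : ∀ h → r (suc h) ≗ shift (r (suc (suc h))) ⊕ r h

-- The recursion determines r (suc h) at n from values at smaller n or smaller h.
Solves-unique : ∀ {p s r r′} → Solves p s r → Solves p s r′ → ∀ h → r h ≗ r′ h
Solves-unique {p} {s} {r} {r′} solves solves′ h n = upTo (suc n) n ≤-refl h
  where
  module R  = Solves solves
  module R′ = Solves solves′
  upTo : ∀ n m → m < n → ∀ h → r h m ≡ r′ h m
  upTo (suc n) m (s≤s m≤n) = at
    where
    shifted : ∀ h i → i ≤ m → shift (r h) i ≡ shift (r′ h) i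
    shifted h zero    _     = refl
    shifted h (suc i) i<m = upTo n i (≤-trans i<m m≤n) h
    at : ∀ h → r h m ≡ r′ h m
    at zero    = trans (R.initial m) (trans (cong (p m +_) (⊛-cong-≤ m {s} (λ _ _ → refl) (shifted 1))) (sym (R′.initial m)))
    at (suc h) = trans (R.step h m) (trans (cong₂ _+_ (shifted (suc (suc h)) m ≤-refl) (at h)) (sym (R′.step h m)))

module _ (k : ℕ) where
  private
    u = shift (aboveSer (suc k) 1)
    c = monomial (catalan (suc k)) (suc k)
    w = c ⊛ u
    s = truncatedBallot 0 (suc k)
    extended : ℕ → FPS
    extended h = aboveSer k h ⊕ (aboveSer k h ⊛ w)

  shift-extended : ∀ h → shift (extended h) ≗ shift (aboveSer k h) ⊕ (shift (aboveSer k h) ⊛ w)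
  shift-extended h zero    = refl
  shift-extended h (suc n) = cong (aboveSer k h n +_) (sym (shift-⊛ (aboveSer k h) w (suc n)))

  -- The dips with exactly `k + 1` down steps are split off. Their term `w` contains the level-1
  -- series of `k + 1` itself, yet is treated as part of the constant term, which leaves the dip
  -- series of `k` as coefficient.
  above-solves : Solves (one ⊕ w) s (aboveSer (suc k))
  above-solves = record
    { initial = λ n → begin
        above (suc k) n 0
          ≡⟨ aboveSer-zero (suc k) n ⟩
        one n + (truncatedBallot 0 (suc (suc k)) ⊛ u) n
          ≡⟨ cong (one n +_) (⊛-congˡ u (truncatedBallot-extend (suc k)) n) ⟩
        one n + ((c ⊕ s) ⊛ u) n
          ≡⟨ cong (one n +_) (⊛-distribʳ u c s n) ⟩
        one n + (w n + (s ⊛ u) n)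
          ≡⟨ +-assoc (one n) _ _ ⟨
        one n + w n + (s ⊛ u) n ∎
    ; step = aboveSer-suc (suc k)
    }

  -- By linearity: the system for `k`, whose constant term is `one`, is multiplied through by
  -- `one ⊕ w`.
  extended-solves : Solves (one ⊕ w) s extended
  extended-solves = record
    { initial = λ n → begin
        above k n 0 + (aboveSer k 0 ⊛ w) n
          ≡⟨ cong₂ _+_ (aboveSer-zero k n) (⊛-congˡ w (aboveSer-zero k) n) ⟩
        one n + (s ⊛ v) n + ((one ⊕ (s ⊛ v)) ⊛ w) n
          ≡⟨ cong (one n + (s ⊛ v) n +_) (trans (⊛-distribʳ w one (s ⊛ v) n) (cong₂ _+_ (⊛-identityˡ w n) (⊛-assoc s v w n))) ⟩
        one n + (s ⊛ v) n + (w n + (s ⊛ (v ⊛ w)) n)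
          ≡⟨ interchange (one n) _ _ _ ⟩
        one n + w n + ((s ⊛ v) n + (s ⊛ (v ⊛ w)) n)
          ≡⟨ cong (one n + w n +_) (⊛-distribˡ s v (v ⊛ w) n) ⟨
        one n + w n + (s ⊛ (v ⊕ (v ⊛ w))) n
          ≡⟨ cong (one n + w n +_) (⊛-congʳ s (shift-extended 1) n) ⟨
        one n + w n + (s ⊛ shift (extended 1)) n ∎
    ; step = λ h n → begin
        above k n (suc h) + (aboveSer k (suc h) ⊛ w) n
          ≡⟨ cong₂ _+_ (aboveSer-suc k h n) (trans (⊛-congˡ w (aboveSer-suc k h) n) (⊛-distribʳ w (shift (aboveSer k (suc (suc h)))) (aboveSer k h) n)) ⟩
        shift (aboveSer k (suc (suc h))) n + above k n h + ((shift (aboveSer k (suc (suc h))) ⊛ w) n + (aboveSer k h ⊛ w) n)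
          ≡⟨ interchange (shift (aboveSer k (suc (suc h))) n) _ _ _ ⟩
        shift (aboveSer k (suc (suc h))) n + (shift (aboveSer k (suc (suc h))) ⊛ w) n + (above k n h + (aboveSer k h ⊛ w) n)
          ≡⟨ cong (_+ extended h n) (shift-extended (suc (suc h)) n) ⟨
        shift (extended (suc (suc h))) n + extended h n ∎
    }
    where
    v = shift (aboveSer k 1)
    interchange : ∀ a b c d → a + b + (c + d) ≡ a + c + (b + d)
    interchange = solve-∀

  aboveSer-step : ∀ h → aboveSer (suc k) h ≗ aboveSer k h ⊕ (aboveSer k h ⊛ w)
  aboveSer-step = Solves-unique above-solves extended-solves

  ⊛-rotate : ∀ f → f ⊛ w ≗ c ⊛ (f ⊛ u)
  ⊛-rotate f n = begin
    (f ⊛ (c ⊛ u)) n   ≡⟨ ⊛-assoc f c u n ⟨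
    ((f ⊛ c) ⊛ u) n   ≡⟨ ⊛-congˡ u (⊛-comm f c) n ⟩
    ((c ⊛ f) ⊛ u) n   ≡⟨ ⊛-assoc c f u n ⟩
    (c ⊛ (f ⊛ u)) n   ∎

  aboveSer-zero-step : aboveSer (suc k) 0 ≗ aboveSer k 0 ⊕ (c ⊛ (aboveSer k 0 ⊛ u))
  aboveSer-zero-step n = trans (aboveSer-step 0 n) (cong (above k n 0 +_) (⊛-rotate (aboveSer k 0) n))

  shift-aboveSer-one-step : u ≗ shift (aboveSer k 1) ⊕ (c ⊛ (shift (aboveSer k 1) ⊛ u))
  shift-aboveSer-one-step zero    = sym (⊛-rotate (shift (aboveSer k 1)) zero)
  shift-aboveSer-one-step (suc n) =
    trans (aboveSer-step 1 n)
      (cong (above k n 1 +_) (trans (sym (shift-⊛ (aboveSer k 1) w (suc n))) (⊛-rotate (shift (aboveSer k 1)) (suc n))))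

-- Counting in the lists of ascending sequences.

count : (List ℕ → Bool) → List (List ℕ) → ℕ
count p xs = length (filterᵇ p xs)

count-++ : ∀ p xs ys → count p (xs ++ ys) ≡ count p xs + count p ys
count-++ p xs ys = trans (cong length (filter-++ (λ x → T? (p x)) xs ys)) (length-++ (filterᵇ p xs))

count-map : ∀ p q f → p ∘ f ≗ q → ∀ xs → count p (map f xs) ≡ count q xs
count-map p q f p≗q []       = refl
count-map p q f p≗q (x ∷ xs) rewrite p≗q x with q x
... | true  = cong suc (count-map p q f p≗q xs)
... | false = count-map p q f p≗q xs

count-none : ∀ p → (∀ x → p x ≡ false) → ∀ xs → count p xs ≡ 0
count-none p none []       = refl
count-none p none (x ∷ xs) rewrite none x = count-none p none xs

interval : ℕ → ℕ → List ℕ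
interval lo zero    = []
interval lo (suc c) = lo ∷ interval (suc lo) c

applyUpTo-interval : ∀ f lo c → (∀ i → f i ≡ lo + i) → applyUpTo f c ≡ interval lo c
applyUpTo-interval f lo zero    f≡ = refl
applyUpTo-interval f lo (suc c) f≡ = cong₂ _∷_ (trans (f≡ 0) (+-identityʳ lo))
  (applyUpTo-interval (f ∘ suc) (suc lo) c (λ i → trans (f≡ (suc i)) (+-suc lo i)))

range-interval : ∀ lo hi → range lo hi ≡ interval lo (suc hi ∸ lo)
range-interval lo hi = trans (map-upTo (lo +_) (suc hi ∸ lo)) (applyUpTo-interval (lo +_) lo _ (λ _ → refl))

fwdCands-interval : ∀ n a → fwdCands n a ≡ interval (suc a) (n ∸ a)
fwdCands-interval n a = trans (map-upTo _ (n ∸ a)) (applyUpTo-interval _ (suc a) _ (λ _ → refl))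

range-≤ : ∀ {lo hi} → lo ≤ hi → range lo hi ≡ lo ∷ range (suc lo) hi
range-≤ {lo} {hi} lo≤hi = begin
  range lo hi                       ≡⟨ range-interval lo hi ⟩
  interval lo (suc hi ∸ lo)         ≡⟨ cong (interval lo) (+-∸-assoc 1 lo≤hi) ⟩
  lo ∷ interval (suc lo) (hi ∸ lo)  ≡⟨ cong (lo ∷_) (range-interval (suc lo) hi) ⟨
  lo ∷ range (suc lo) hi            ∎

-- The branching of the lattice path: either the next car prefers `lo`, an up step, or no remaining
-- car does and the lower bound moves on, a down step.
ascSeqs-≤ : ∀ l {lo hi} → lo ≤ hi →
  ascSeqs (suc l) lo hi ≡ map (lo ∷_) (ascSeqs l lo hi) ++ ascSeqs (suc l) (suc lo) hi
ascSeqs-≤ l {lo} {hi} lo≤hi = cong (concatMap (λ a → map (a ∷_) (ascSeqs l a hi))) (range-≤ lo≤hi)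

ascSeqs-empty : ∀ l hi → ascSeqs (suc l) (suc hi) hi ≡ []
ascSeqs-empty l hi rewrite range-interval (suc hi) hi | n∸n≡0 hi = refl

-- The search order of a car.

descending : ℕ → ℕ → List ℕ
descending zero    b       = []
descending (suc c) zero    = []
descending (suc c) (suc b) = suc b ∷ descending c b

backCands-from : ℕ → List ℕ → List ℕ
backCands-from a ds = map (λ d → a ∸ d) (filterᵇ (λ d → d <ᵇ a) ds)

backCands-from-≥ : ∀ a f → (∀ i → a ≤ f i) → ∀ k → backCands-from a (applyUpTo f k) ≡ []
backCands-from-≥ a f a≤f zero = refl
backCands-from-≥ a f a≤f (suc k)
  rewrite dec-false (f 0 <? a) (≤⇒≯ (a≤f 0)) = backCands-from-≥ a (f ∘ suc) (a≤f ∘ suc) k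

-- Stated for a general offset function because `applyUpTo` recurses by replacing `f` with
-- `f ∘ suc`; the hypothesis says that `a ∸ f i` runs down from `b`.
backCands-from-descending : ∀ a b f → (∀ i → f i + b ≡ a + i) → ∀ k →
  backCands-from a (applyUpTo f k) ≡ descending k b
backCands-from-descending a b       f f≡ zero    = refl
backCands-from-descending a zero    f f≡ (suc k) =
  backCands-from-≥ a f (λ i → ≤-trans (m≤m+n a i) (≤-reflexive (trans (sym (f≡ i)) (+-identityʳ (f i))))) (suc k)
backCands-from-descending a (suc b) f f≡ (suc k)
  rewrite dec-true (f 0 <? a) (≤-trans (m<m+n (f 0) (s≤s z≤n)) (≤-reflexive (trans (f≡ 0) (+-identityʳ a)))) =
  cong₂ _∷_ (trans (cong (_∸ f 0) (sym f0≡)) (m+n∸m≡n (f 0) (suc b)))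
    (backCands-from-descending a b (f ∘ suc)
      (λ i → suc-injective (trans (sym (+-suc (f (suc i)) b)) (trans (f≡ (suc i)) (+-suc a i)))) k)
  where
  f0≡ : f 0 + suc b ≡ a
  f0≡ = trans (f≡ 0) (+-identityʳ a)

backCands-descending : ∀ k b → backCands k (suc b) ≡ descending k b
backCands-descending k b = trans (cong (backCands-from (suc b)) (map-upTo suc k))
  (backCands-from-descending (suc b) b suc (λ i → cong suc (+-comm i b)) k)

-- The preferred spot heads the descending list, so preference, backing up and driving forward
-- become a single search with `k + 1` descending candidates.
chooseSpot-firstFree : ∀ n k occ b →
  chooseSpot n k occ (suc b) ≡ firstFree occ (descending (suc k) (suc b) ++ interval (suc (suc b)) (n ∸ suc b))
chooseSpot-firstFree n k occ b
  rewrite backCands-descending k b | fwdCands-interval n (suc b) = refl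

-- Occupied and free spots.

OccupiedOn : List ℕ → ℕ → ℕ → Set
OccupiedOn occ a b = ∀ s → a < s → s ≤ b → free occ s ≡ false

-- Numbers beyond the last spot are included, as `free` looks only at the parked cars; this keeps
-- `n` out of the invariants.
FreeAbove : List ℕ → ℕ → Set
FreeAbove occ a = ∀ s → a < s → free occ s ≡ true

true≢false : ∀ {b} → b ≡ true → b ≡ false → ⊥
true≢false refl ()

free-parked : ∀ t occ → free (t ∷ occ) t ≡ false
free-parked t occ rewrite dec-true (t ≟ t) refl = refl

free-unparked : ∀ {t s} occ → t ≢ s → free (t ∷ occ) s ≡ free occ s
free-unparked {t} {s} occ t≢s rewrite dec-false (t ≟ s) t≢s = refl

occupied-stays : ∀ t s occ → free occ s ≡ false → free (t ∷ occ) s ≡ false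
occupied-stays t s occ fs with t ≡ᵇ s
... | true  = refl
... | false = fs

freeAbove-parked : ∀ {t a} occ → t ≤ a → FreeAbove occ a → FreeAbove (t ∷ occ) a
freeAbove-parked occ t≤a fa s a<s = trans (free-unparked occ (<⇒≢ (≤-<-trans t≤a a<s))) (fa s a<s)

freeCount : List ℕ → ℕ → ℕ
freeCount occ zero    = 0
freeCount occ (suc b) = (if free occ (suc b) then 1 else 0) + freeCount occ b

freeCount-above : ∀ {t} occ b → b < t → freeCount (t ∷ occ) b ≡ freeCount occ b
freeCount-above occ zero    b<t = refl
freeCount-above occ (suc b) b<t
  rewrite free-unparked occ (≢-sym (<⇒≢ b<t)) = cong ((if free occ (suc b) then 1 else 0) +_) (freeCount-above occ b (<-trans (n<1+n b) b<t))

freeCount-parked : ∀ {t} occ b → free occ t ≡ true → 0 < t → t ≤ b →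
  freeCount occ b ≡ suc (freeCount (t ∷ occ) b)
freeCount-parked {suc t} occ (suc b) ft 0<t t≤b with suc t ≟ suc b
... | yes refl rewrite free-parked (suc b) occ | ft = cong suc (sym (freeCount-above occ b ≤-refl))
... | no t≢b rewrite free-unparked occ t≢b =
  trans (cong (x +_) (freeCount-parked occ b ft 0<t (s≤s⁻¹ (≤∧≢⇒< t≤b t≢b)))) (+-suc x (freeCount (suc t ∷ occ) b))
  where x = if free occ (suc b) then 1 else 0

freeCount-occupied : ∀ occ {a b} → a ≤ b → OccupiedOn occ a b → freeCount occ b ≡ freeCount occ a
freeCount-occupied occ {b = zero} z≤n    o = refl
freeCount-occupied occ {a} {suc b} a≤b o with a ≟ suc b
... | yes refl = refl
... | no a≢b rewrite o (suc b) (≤∧≢⇒< a≤b a≢b) ≤-refl =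
  freeCount-occupied occ (s≤s⁻¹ (≤∧≢⇒< a≤b a≢b)) (λ s a<s s≤b → o s a<s (m≤n⇒m≤1+n s≤b))

freeCount-freeAbove : ∀ occ {a} d → FreeAbove occ a → freeCount occ (a + d) ≡ d + freeCount occ a
freeCount-freeAbove occ {a} zero    fa rewrite +-identityʳ a = refl
freeCount-freeAbove occ {a} (suc d) fa
  rewrite +-suc a d | fa (suc (a + d)) (s≤s (m≤m+n a d)) = cong suc (freeCount-freeAbove occ d fa)

freeCount≡0⇒occupied : ∀ occ b → freeCount occ b ≡ 0 → OccupiedOn occ 0 b
freeCount≡0⇒occupied occ zero    fc≡0 s 0<s s≤b = contradiction s≤b (<⇒≱ 0<s)
freeCount≡0⇒occupied occ (suc b) fc≡0 s 0<s s≤b with free occ (suc b) in fb | s ≟ suc b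
... | false | yes refl = fb
... | false | no s≢b   = freeCount≡0⇒occupied occ b fc≡0 s 0<s (s≤s⁻¹ (≤∧≢⇒< s≤b s≢b))

firstFree-sound : ∀ {P : ℕ → Set} occ {xs t} → All P xs → firstFree occ xs ≡ just t → free occ t ≡ true × P t
firstFree-sound occ {x ∷ xs} (px ∷ pxs) eq with free occ x in fx
firstFree-sound occ {x ∷ xs} (px ∷ pxs) refl | true  = fx , px
firstFree-sound occ {x ∷ xs} (px ∷ pxs) eq   | false = firstFree-sound occ pxs eq

descending-bounds : ∀ lo c b → lo + c ≤ b → All (λ t → lo < t × t ≤ b) (descending c b)
descending-bounds lo zero    b       _     = []
descending-bounds lo (suc c) zero    _     = []
descending-bounds lo (suc c) (suc b) lo+c≤b =
  (s≤s (≤-trans (m≤m+n lo c) lo+c≤′), ≤-refl)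
  ∷ All.map (λ (lo<t , t≤b) → lo<t , m≤n⇒m≤1+n t≤b) (descending-bounds lo c b lo+c≤′)
  where
  lo+c≤′ : lo + c ≤ b
  lo+c≤′ = s≤s⁻¹ (≤-trans (≤-reflexive (sym (+-suc lo c))) lo+c≤b)

interval-bounds : ∀ lo c → All (λ t → lo ≤ t × t < lo + c) (interval lo c)
interval-bounds lo zero    = []
interval-bounds lo (suc c) =
  (≤-refl , m<m+n lo (s≤s z≤n))
  ∷ All.map (λ (lo<t , t<) → <⇒≤ lo<t , ≤-trans t< (≤-reflexive (sym (+-suc lo c)))) (interval-bounds (suc lo) c)

record LastFree (occ : List ℕ) (a t : ℕ) : Set where
  constructor lastFree
  field
    isFree   : free occ t ≡ true
    positive : 0 < t
    bounded  : t ≤ a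
    maximal  : OccupiedOn occ t a

-- The candidates run from `b` down to `b + 1 - c`, so `b ≤ s + c` puts the free spot `suc s` among
-- them and the search never reaches `ys`.
firstFree-descending : ∀ occ c b ys s → free occ (suc s) ≡ true → s < b → b ≤ s + c →
  ∃ λ t → firstFree occ (descending c b ++ ys) ≡ just t × LastFree occ b t
firstFree-descending occ zero    b       ys s fs s<b b≤ = contradiction (≤-trans b≤ (≤-reflexive (+-identityʳ s))) (<⇒≱ s<b)
firstFree-descending occ (suc c) (suc b) ys s fs s<b b≤ with free occ (suc b) in fb
... | true  = suc b , refl , lastFree fb (s≤s z≤n) ≤-refl (λ u b<u u≤b → contradiction u≤b (<⇒≱ b<u))
... | false =
  let t , eq , lastFree ft 0<t t≤b o = firstFree-descending occ c b ys s fs s<b′ b≤′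
  in t , eq , lastFree ft 0<t (m≤n⇒m≤1+n t≤b) (λ u t<u u≤b → extend u t<u u≤b o)
  where
  s<b′ : s < b
  s<b′ = ≤∧≢⇒< (s≤s⁻¹ s<b) (λ { refl → true≢false fs fb })
  b≤′ : b ≤ s + c
  b≤′ = s≤s⁻¹ (≤-trans b≤ (≤-reflexive (+-suc s c)))
  extend : ∀ {t} u → t < u → u ≤ suc b → OccupiedOn occ t b → free occ u ≡ false
  extend u t<u u≤b o with u ≟ suc b
  ... | yes refl = fb
  ... | no u≢b   = o u t<u (s≤s⁻¹ (≤∧≢⇒< u≤b u≢b))

firstFree-descending-occupied : ∀ occ c b ys → OccupiedOn occ 0 b →
  firstFree occ (descending c b ++ ys) ≡ firstFree occ ys
firstFree-descending-occupied occ zero    b       ys o = refl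
firstFree-descending-occupied occ (suc c) zero    ys o = refl
firstFree-descending-occupied occ (suc c) (suc b) ys o rewrite o (suc b) (s≤s z≤n) ≤-refl =
  firstFree-descending-occupied occ c b ys (λ s 0<s s≤b → o s 0<s (m≤n⇒m≤1+n s≤b))

firstFree-interval : ∀ occ lo c d → OccupiedOn occ 0 (lo + d) → free occ (suc (lo + d)) ≡ true → d < c →
  firstFree occ (interval (suc lo) c) ≡ just (suc (lo + d))
firstFree-interval occ lo (suc c) zero    o f d<c rewrite +-identityʳ lo | f = refl
firstFree-interval occ lo (suc c) (suc d) o f d<c
  rewrite o (suc lo) (s≤s z≤n) (m<m+n lo (s≤s z≤n)) | +-suc lo d = firstFree-interval occ (suc lo) c d o f (s≤s⁻¹ d<c)

-- Invariants of the parking state above level 0 and inside a dip.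

record Filled (occ : List ℕ) (m : ℕ) : Set where
  constructor filled
  field
    occupied  : OccupiedOn occ 0 m
    freeAbove : FreeAbove occ m

-- Only the leftmost gap and the number of gaps are recorded: cars fill gaps from the right, so
-- these decide when the dip ends and whether it can. The count is `suc g`, which makes `g` the
-- depth below level 0.
record Gapped (occ : List ℕ) (s a g : ℕ) : Set where
  constructor gapped
  field
    occupied  : OccupiedOn occ 0 s
    firstGap  : free occ (suc s) ≡ true
    freeAbove : FreeAbove occ a
    gaps      : freeCount occ a ≡ suc g

Filled-park : ∀ {occ m} → Filled occ m → Filled (suc m ∷ occ) (suc m)
Filled-park {occ} {m} (filled o f) = filled o′ (freeAbove-parked occ ≤-refl (λ s m<s → f s (<-trans (n<1+n m) m<s)))
  where
  o′ : OccupiedOn (suc m ∷ occ) 0 (suc m)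
  o′ s 0<s s≤m with s ≟ suc m
  ... | yes refl = free-parked (suc m) occ
  ... | no s≢m   = occupied-stays (suc m) s occ (o s 0<s (s≤s⁻¹ (≤∧≢⇒< s≤m s≢m)))

Filled⇒Gapped : ∀ {occ m} → Filled occ m → Gapped occ m (suc m) 0
Filled⇒Gapped {occ} {m} (filled o f) = gapped o (f (suc m) ≤-refl) (λ s m<s → f s (<-trans (n<1+n m) m<s))
  (cong₂ (λ b c → (if b then 1 else 0) + c) (f (suc m) ≤-refl) (freeCount-occupied occ z≤n o))

Gapped-suc : ∀ {occ s a g} → Gapped occ s a g → Gapped occ s (suc a) (suc g)
Gapped-suc {a = a} (gapped o fs fa fc) = gapped o fs (λ u a<u → fa u (<-trans (n<1+n a) a<u))
  (cong₂ (λ b c → (if b then 1 else 0) + c) (fa (suc a) ≤-refl) fc)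

Gapped-fill-last : ∀ {occ s a t} → Gapped occ s a 0 → LastFree occ a t → Filled (t ∷ occ) a
Gapped-fill-last {occ} {a = a} {t} (gapped o fs fa fc) (lastFree ft 0<t t≤a _) = filled
  (freeCount≡0⇒occupied (t ∷ occ) a (suc-injective (trans (sym (freeCount-parked occ a ft 0<t t≤a)) fc)))
  (freeAbove-parked occ t≤a fa)

Gapped-fill : ∀ {occ s a g t} → Gapped occ s a (suc g) → LastFree occ a t → Gapped (t ∷ occ) s a g
Gapped-fill {occ} {s} {a} {t = t} (gapped o fs fa fc) (lastFree ft 0<t t≤a ot) = gapped
  (λ v 0<v v≤s → occupied-stays t v occ (o v 0<v v≤s))
  (trans (free-unparked occ t≢s) fs)
  (freeAbove-parked occ t≤a fa)
  (suc-injective (trans (sym (freeCount-parked occ a ft 0<t t≤a)) fc))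
  where
  -- If the rightmost free spot were also the leftmost gap, there would be one gap, not two or more.
  t≢s : t ≢ suc s
  t≢s refl = contradiction
    (trans (sym fc) (trans (freeCount-occupied occ t≤a ot)
      (cong₂ (λ b c → (if b then 1 else 0) + c) fs (freeCount-occupied occ z≤n o))))
    λ ()

-- Parking counts as path counts.

module _ (n k : ℕ) where

  naplesCount : List ℕ → List (List ℕ) → ℕ
  naplesCount occ = count (λ p → is-just (runPark n k occ p))

  naplesCount-just : ∀ {t} occ l a → a ≤ n → chooseSpot n k occ a ≡ just t →
    naplesCount occ (ascSeqs (suc l) a n) ≡ naplesCount (t ∷ occ) (ascSeqs l a n) + naplesCount occ (ascSeqs (suc l) (suc a) n)
  naplesCount-just {t} occ l a a≤n eq rewrite ascSeqs-≤ l a≤n =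
    trans (count-++ _ (map (a ∷_) (ascSeqs l a n)) _) (cong (_+ naplesCount occ (ascSeqs (suc l) (suc a) n)) (count-map _ _ (a ∷_) park (ascSeqs l a n)))
    where
    park : ∀ as → is-just (runPark n k occ (a ∷ as)) ≡ is-just (runPark n k (t ∷ occ) as)
    park as rewrite eq = refl

  naplesCount-nothing : ∀ occ l a → a ≤ n → chooseSpot n k occ a ≡ nothing →
    naplesCount occ (ascSeqs (suc l) a n) ≡ naplesCount occ (ascSeqs (suc l) (suc a) n)
  naplesCount-nothing occ l a a≤n eq rewrite ascSeqs-≤ l a≤n =
    trans (count-++ _ (map (a ∷_) (ascSeqs l a n)) _) (cong (_+ naplesCount occ (ascSeqs (suc l) (suc a) n))
      (trans (count-map _ (λ _ → false) (a ∷_) fail (ascSeqs l a n)) (count-none _ (λ _ → refl) (ascSeqs l a n))))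
    where
    fail : ∀ as → is-just (runPark n k occ (a ∷ as)) ≡ false
    fail as rewrite eq = refl

  -- Once every remaining car prefers a spot more than k above a free spot, that
  -- spot stays free, which leaves too few spots for the remaining cars.
  naplesCount-stuck : ∀ l d a occ s → a + d ≡ n → s + k < a → suc s ≤ n →
    free occ (suc s) ≡ true → freeCount occ n ≡ l → naplesCount occ (ascSeqs l (suc a) n) ≡ 0
  naplesCount-stuck zero d a occ s a+d≡n s<a s≤n fs fc =
    ⊥-elim (true≢false fs (freeCount≡0⇒occupied occ n fc (suc s) (s≤s z≤n) s≤n))
  naplesCount-stuck (suc l) zero a occ s a≡n s<a s≤n fs fc
    rewrite trans (sym (+-identityʳ a)) a≡n | ascSeqs-empty l n = refl
  naplesCount-stuck (suc l) (suc d) a occ s a+d≡n s<a s≤n fs fc with chooseSpot n k occ (suc a) in eq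
  ... | nothing = trans (naplesCount-nothing occ l (suc a) a<n eq) later
    where
    a<n : suc a ≤ n
    a<n = ≤-trans (m<m+n a (s≤s z≤n)) (≤-reflexive a+d≡n)
    later = naplesCount-stuck (suc l) d (suc a) occ s (trans (sym (+-suc a d)) a+d≡n) (m<n⇒m<1+n s<a) s≤n fs fc
  ... | just t = trans (naplesCount-just occ l (suc a) a<n eq) (cong₂ _+_ parked later)
    where
    a<n : suc a ≤ n
    a<n = ≤-trans (m<m+n a (s≤s z≤n)) (≤-reflexive a+d≡n)
    later = naplesCount-stuck (suc l) d (suc a) occ s (trans (sym (+-suc a d)) a+d≡n) (m<n⇒m<1+n s<a) s≤n fs fc
    -- The `k + 1` descending candidates end at `a + 1 - k`, which exceeds `s + 1`, so no choice can
    -- fill the spot `suc s`.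
    candidates : All (λ t → suc s < t × t ≤ n) (descending (suc k) (suc a) ++ interval (suc (suc a)) (n ∸ suc a))
    candidates = ++⁺
      (All.map (λ (s<t , t≤a) → s<t , ≤-trans t≤a a<n)
        (descending-bounds (suc s) (suc k) (suc a) (s≤s (≤-trans (≤-reflexive (+-suc s k)) s<a))))
      (All.map (λ (a<t , t<) → ≤-<-trans (≤-trans (s≤s (m≤m+n s k)) s<a) (<-trans (n<1+n a) a<t) , s≤s⁻¹ (≤-trans t< (≤-reflexive (cong suc (m+[n∸m]≡n a<n)))))
        (interval-bounds (suc (suc a)) (n ∸ suc a)))
    spot = firstFree-sound occ candidates (trans (sym (chooseSpot-firstFree n k occ a)) eq)
    s<t = proj₁ (proj₂ spot)
    parked = naplesCount-stuck l (suc d) a (t ∷ occ) s a+d≡n s<a s≤n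
      (trans (free-unparked occ (≢-sym (<⇒≢ s<t))) fs)
      (suc-injective (trans (sym (freeCount-parked occ n (proj₁ spot) (≤-trans (s≤s z≤n) s<t) (proj₂ (proj₂ spot)))) fc))

  chooseSpot-filled : ∀ occ a h → Filled occ (suc a + h) → suc a + h < n →
    chooseSpot n k occ (suc a) ≡ just (suc (suc a + h))
  chooseSpot-filled occ a h (filled o f) m<n = trans (chooseSpot-firstFree n k occ a)
    (trans (firstFree-descending-occupied occ (suc k) (suc a) _ (λ s 0<s s≤a → o s 0<s (≤-trans s≤a (m≤m+n (suc a) h))))
      (firstFree-interval occ (suc a) (n ∸ suc a) h o (f (suc (suc a + h)) ≤-refl)
        (m+n≤o⇒m≤o∸n (suc h) (≤-trans (≤-reflexive (cong suc (+-comm h (suc a)))) m<n))))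

  -- The distance `e` to the first gap is at most `k`, so the backward search succeeds and takes the
  -- nearest gap.
  chooseSpot-gapped : ∀ occ s e t g → e + suc t ≡ suc k → Gapped occ s (suc s + e) g →
    ∃ λ u → chooseSpot n k occ (suc s + e) ≡ just u × LastFree occ (suc s + e) u
  chooseSpot-gapped occ s e t g e+t≡ gap =
    let u , eq , last = firstFree-descending occ (suc k) (suc s + e) (interval (suc (suc s + e)) (n ∸ (suc s + e))) s
                          (Gapped.firstGap gap) (s≤s (m≤m+n s e)) reach
    in u , trans (chooseSpot-firstFree n k occ (s + e)) eq , last
    where
    reach : suc s + e ≤ s + suc k
    reach = ≤-trans (≤-reflexive (sym (+-suc s e))) (+-monoʳ-≤ s (≤-trans (m<m+n e (s≤s z≤n)) (≤-reflexive e+t≡)))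

  naplesCount-above-just : ∀ occ l a h → suc a + h + suc l ≡ n → Filled occ (suc a + h) →
    naplesCount occ (ascSeqs (suc l) (suc a) n)
      ≡ naplesCount (suc (suc a + h) ∷ occ) (ascSeqs l (suc a) n) + naplesCount occ (ascSeqs (suc l) (suc (suc a)) n)
  naplesCount-above-just occ l a h m+l≡n fill =
    naplesCount-just occ l (suc a) (≤-trans (m≤m+n (suc a) h) (<⇒≤ m<n)) (chooseSpot-filled occ a h fill m<n)
    where
    m<n : suc a + h < n
    m<n = ≤-trans (m<m+n (suc a + h) (s≤s z≤n)) (≤-reflexive m+l≡n)

  -- The level is `m - a`, that is `h + 1`. A car preferring `a + 1` finds all spots up to `m` taken
  -- and parks at `m + 1`, an up step; passing on to `a + 2` is a down step. `m + l ≡ n` matches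
  -- cars left with spots left.
  naplesCount-above : ∀ l h a m occ → m ≡ suc a + h → m + l ≡ n → Filled occ m →
    naplesCount occ (ascSeqs l (suc a) n) ≡ above k l (suc h)

  -- Here `e` is the distance from the first gap to the current spot `a`, and `d` counts the spots
  -- from `a` to `n`. The free spots are `g + 1` up to `a` and the rest beyond it, so
  -- `suc l ≡ d + g` again matches cars with free spots.
  naplesCount-below : ∀ l g t a e s d occ → a ≡ suc s + e → e + t ≡ suc k → a + d ≡ suc n → suc l ≡ d + g →
    Gapped occ s a g → naplesCount occ (ascSeqs (suc l) a n) ≡ below k (suc l) g t

  naplesCount-above zero    h a m occ m≡ m+l≡n fill = sym (above-zero k (suc h))
  naplesCount-above (suc l) zero a .(suc a + zero) occ refl m+l≡n fill =
    trans (naplesCount-above-just occ l a zero m+l≡n fill) (cong₂ _+_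
      (naplesCount-above l 1 a (suc (suc a + zero)) (suc (suc a + zero) ∷ occ)
        (sym (+-suc (suc a) zero)) (trans (sym (+-suc (suc a + zero) l)) m+l≡n) (Filled-park fill))
      -- The down step from level 1 to level 0: the new current spot `a + 2` is itself the first
      -- gap, so the distance is 0 and the full allowance `suc k` is available.
      (naplesCount-below l 0 (suc k) (suc (suc a)) 0 (suc a) (suc l) occ
        (sym (+-identityʳ _)) refl (cong suc (subst (λ m → m + suc l ≡ n) (+-identityʳ (suc a)) m+l≡n)) (sym (+-identityʳ (suc l)))
        (Filled⇒Gapped (subst (Filled occ) (+-identityʳ (suc a)) fill))))
  naplesCount-above (suc l) (suc h) a .(suc a + suc h) occ refl m+l≡n fill =
    trans (naplesCount-above-just occ l a (suc h) m+l≡n fill) (cong₂ _+_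
      (naplesCount-above l (suc (suc h)) a (suc (suc a + suc h)) (suc (suc a + suc h) ∷ occ)
        (sym (+-suc (suc a) (suc h))) (trans (sym (+-suc (suc a + suc h) l)) m+l≡n) (Filled-park fill))
      (naplesCount-above (suc l) h (suc a) (suc a + suc h) occ (+-suc (suc a) h) m+l≡n fill))

  -- The current spot is `n + 1`, so no preference is left for the remaining cars; here `g` equals
  -- `suc l` and `below` vanishes as well.
  naplesCount-below l g t a e s zero occ a≡ e+t≡ a≡n refl gap
    rewrite trans (sym (+-identityʳ a)) a≡n | ascSeqs-empty l n = sym (below-vanishes k (suc l) (suc l) t ≤-refl)
  -- Now `e` is `k + 1`: every further preference is more than `k` above the first gap.
  naplesCount-below l g zero .(suc s + e) e s (suc d) occ refl e+t≡ a+d≡n l≡ (gapped o fs fa fc) =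
    naplesCount-stuck (suc l) (suc d) (s + e) occ s (suc-injective a+d≡n)
      (+-monoʳ-< s (≤-reflexive (trans (sym e+t≡) (+-identityʳ e))))
      (≤-trans (m≤m+n (suc s) e) (≤-trans (m≤m+n (suc s + e) d) (≤-reflexive a+d≡n′)))
      fs
      (trans (cong (freeCount occ) (sym a+d≡n′))
        (trans (freeCount-freeAbove occ d fa) (trans (cong (d +_) fc) (trans (+-suc d g) (sym l≡)))))
    where
    a+d≡n′ : suc s + e + d ≡ n
    a+d≡n′ = suc-injective (trans (sym (+-suc (suc s + e) d)) a+d≡n)
  naplesCount-below l g (suc t) .(suc s + e) e s (suc d) occ refl e+t≡ a+d≡n l≡ gap =
    let u , eq , last = chooseSpot-gapped occ s e t g e+t≡ gap
    in trans (naplesCount-just occ l a a≤n eq) (up l g l≡ gap last)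
    where
    a = suc s + e
    a+d≡n′ : a + d ≡ n
    a+d≡n′ = suc-injective (trans (sym (+-suc a d)) a+d≡n)
    a≤n : a ≤ n
    a≤n = ≤-trans (m≤m+n a d) (≤-reflexive a+d≡n′)
    down : ∀ l g → suc l ≡ suc d + g → Gapped occ s a g →
      naplesCount occ (ascSeqs (suc l) (suc a) n) ≡ below k (suc l) (suc g) t
    down l g l≡ gap = naplesCount-below l (suc g) t (suc a) (suc e) s d occ
      (sym (+-suc (suc s) e)) (trans (sym (+-suc e t)) e+t≡) (cong suc a+d≡n′)
      (trans l≡ (sym (+-suc d g))) (Gapped-suc gap)
    up : ∀ {u} l g → suc l ≡ suc d + g → Gapped occ s a g → LastFree occ a u →
      naplesCount (u ∷ occ) (ascSeqs l a n) + naplesCount occ (ascSeqs (suc l) (suc a) n) ≡ below k (suc l) g (suc t)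
    up {u} l zero l≡ gap last = cong₂ _+_
      (naplesCount-above l 0 (s + e) a (u ∷ occ) (sym (+-identityʳ a))
        (trans (cong (a +_) (suc-injective (trans l≡ (+-identityʳ (suc d))))) a+d≡n′)
        (Gapped-fill-last gap last))
      (down l zero l≡ gap)
    up zero (suc g) l≡ gap last = contradiction (trans (suc-injective l≡) (+-suc d g)) λ ()
    up {u} (suc l) (suc g) l≡ gap last = cong₂ _+_
      (naplesCount-below l g (suc t) a e s (suc d) (u ∷ occ) refl e+t≡ a+d≡n
        (trans (suc-injective l≡) (+-suc d g)) (Gapped-fill gap last))
      (down (suc l) (suc g) l≡ gap)

-- From path counts to the power series identities.

-- On the empty street spot 1 is both the current spot and the first gap, so the path starts at
-- level 0 with distance 0 and allowance `suc k`.
Iser-above : ∀ k → Iser k ≗ aboveSer k 0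
Iser-above k zero    = refl
Iser-above k (suc l) = naplesCount-below (suc l) k l 0 (suc k) 1 0 0 (suc l) [] refl refl refl (sym (+-identityʳ (suc l)))
  (gapped (λ s 0<s s≤0 → contradiction s≤0 (<⇒≱ 0<s)) refl (λ _ _ → refl) refl)

startsWith1-≥2 : ∀ (p : List ℕ → Bool) l lo hi → count (λ x → p x ∧ startsWith1 x) (ascSeqs (suc l) (suc (suc lo)) hi) ≡ 0
startsWith1-≥2 p l lo hi rewrite range-interval (suc (suc lo)) hi = none lo (suc hi ∸ suc (suc lo))
  where
  q : List ℕ → Bool
  q x = p x ∧ startsWith1 x
  block : ℕ → List (List ℕ)
  block a = map (a ∷_) (ascSeqs l a hi)
  none : ∀ lo c → count q (concatMap block (interval (suc (suc lo)) c)) ≡ 0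
  none lo zero    = refl
  none lo (suc c) = trans (count-++ q (block (suc (suc lo))) _) (cong₂ _+_
    (trans (count-map q (λ _ → false) (suc (suc lo) ∷_) (λ x → ∧-zeroʳ (p (suc (suc lo) ∷ x))) (ascSeqs l (suc (suc lo)) hi))
      (count-none (λ _ → false) (λ _ → refl) (ascSeqs l (suc (suc lo)) hi)))
    (none (suc lo) c))

-- A first entry 1 forces the first step up, which leaves `l` cars at level 1; `shift` accounts for
-- that car and gives coefficient 0 in degree 0.
User-above : ∀ k → User k ≗ shift (aboveSer k 1)
User-above k zero    = refl
User-above k (suc l) = begin
  count q (ascSeqs (suc l) 1 n)
    ≡⟨ cong (count q) (ascSeqs-≤ l (s≤s z≤n)) ⟩
  count q (map (1 ∷_) (ascSeqs l 1 n) ++ ascSeqs (suc l) 2 n)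
    ≡⟨ count-++ q (map (1 ∷_) (ascSeqs l 1 n)) _ ⟩
  count q (map (1 ∷_) (ascSeqs l 1 n)) + count q (ascSeqs (suc l) 2 n)
    ≡⟨ cong₂ _+_ (count-map q _ (1 ∷_) (λ p → ∧-identityʳ (isNaplesPF n k (1 ∷ p))) (ascSeqs l 1 n)) (startsWith1-≥2 (isNaplesPF n k) l 0 n) ⟩
  naplesCount n k (1 ∷ []) (ascSeqs l 1 n) + 0
    ≡⟨ +-identityʳ _ ⟩
  naplesCount n k (1 ∷ []) (ascSeqs l 1 n)
    ≡⟨ naplesCount-above n k l 0 0 1 (1 ∷ []) refl refl
         (filled (λ { (suc zero) _ _ → refl ; (suc (suc s)) _ (s≤s ()) })
                 (λ { (suc (suc s)) _ → refl ; (suc zero) (s≤s ()) })) ⟩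
  above k l 1 ∎
  where
  n = suc l
  q : List ℕ → Bool
  q p = isNaplesPF n k p ∧ startsWith1 p

theorem5p6 : (k : ℕ) →
    ((n : ℕ) → Iser (suc k) n
    ≡ (Iser k ⊕ (monomial (catalan (suc k)) (suc k) ⊛ (Iser k ⊛ User (suc k)))) n)
    × ((n : ℕ) → User (suc k) n
    ≡ (User k ⊕ (monomial (catalan (suc k)) (suc k) ⊛ (User k ⊛ User (suc k)))) n)
theorem5p6 k = step Iser-above (aboveSer-zero-step k) , step User-above (shift-aboveSer-one-step k)
  where
  c = monomial (catalan (suc k)) (suc k)
  step : ∀ {F f : ℕ → FPS} → (∀ k → F k ≗ f k) →
    f (suc k) ≗ f k ⊕ (c ⊛ (f k ⊛ shift (aboveSer (suc k) 1))) →
    F (suc k) ≗ F k ⊕ (c ⊛ (F k ⊛ User (suc k)))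
  step {F} {f} F≗f rec n = begin
    F (suc k) n
      ≡⟨ F≗f (suc k) n ⟩
    f (suc k) n
      ≡⟨ rec n ⟩
    f k n + (c ⊛ (f k ⊛ shift (aboveSer (suc k) 1))) n
      ≡⟨ cong₂ _+_ (F≗f k n) (⊛-congʳ c (⊛-cong (F≗f k) (User-above (suc k))) n) ⟨
    F k n + (c ⊛ (F k ⊛ User (suc k))) n ∎
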